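{- Let $A$ be a finite set of colours, let $H$ be the characteristic series of the set of planted $A$-coloured tall trees, and let $H^*$ be the characteristic series of the set of all $A$-coloured tall trees. With respect to the deconcatenation coproduct $\delta$, the series $H$ is a primitive element of the restricted dual $(\Bbbk T_A,\,.\,,\Delta)^\circ$, $$\delta(H)=\bullet\otimes H+H\otimes\bullet,$$ and the series $H^*$ is group-like, $$\delta(H^*)=H^*\otimes H^* .$$
   Context: $\Bbbk$ is a field of characteristic zero. A rooted ordered coloured (ROC) tree over a finite set $A$ is a finite rooted tree, with the children of every vertex totally ordered, together with a function from its set of edges to $A$. $T_A$ is the set of ROC trees, $\Bbbk T_A$ the $\Bbbk$-vector space with basis $T_A$, and $\bullet$ the trivial tree (root only). Product: $t\,.\,s$ is obtained by identifying the roots of $t$ and $s$, placing the branches of $t$ to the left of those of $s$; the unit is $\bullet$. Pruning coproduct: $\Delta(t)=\sum t_c\otimes t_s$ over all subtrees $t_s$ of $t$ containing the root (including $\bullet$ and $t$), where $t_c$ is the concatenation of the planted branches of $t$ pruned to obtain $t_s$, in the order inherited from $t$ (left-to-right depth-first order). With these operations $\Bbbk T_A$ is a graded connected Hopf algebra. For $a\in A$, $B_a^+(t)$ is obtained by attaching the root of $t$ to a new root by an additional edge coloured $a$. A planted tall tree is a tree $(B_{a_k}^+\circ\dots\circ B_{a_1}^+)(\bullet)$ with $k\ge1$, $a_i\in A$; it corresponds to the non-empty word $a_1\cdots a_k$. A tall tree is a concatenation of finitely many (possibly zero) planted tall trees; tall trees correspond to sentences over $A$ (finite sequences of non-empty words),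 and planted tall trees to single-word sentences. Thus $H=\sum_w(w)$ over non-empty words $w$ and $H^*=\sum_I I$ over all sentences $I$ (including the empty one, i.e. $\bullet$). A formal tree series is a linear functional $G\in(\Bbbk T_A)^*$, written $G=\sum_{t\in T_A}\langle G,t\rangle t$. Its deconcatenation coproduct is $\delta(G)=\sum_{t,s\in T_A}\langle G,t\,.\,s\rangle\,t\otimes s\in(\Bbbk T_A\otimes\Bbbk T_A)^*$, and $(\Bbbk T_A)^*\otimes(\Bbbk T_A)^*$ is regarded as a subspace via $G_1\otimes G_2=\sum_{t,s}\langle G_1,t\rangle\langle G_2,s\rangle\,t\otimes s$. The restricted (Sweedler) dual $(\Bbbk T_A,\,.\,,\Delta)^\circ$ is the set of $G\in(\Bbbk T_A)^*$ with $\delta(G)\in(\Bbbk T_A)^*\otimes(\Bbbk T_A)^*$. -}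

module Defs where

open import Level using (Level; _⊔_)
open import Algebra.Bundles using (CommutativeRing)
open import Algebra.Apartness.Bundles using (HeytingField; HeytingCommutativeRing)
import Algebra.Definitions.RawMonoid as RawMonoidDefs
open import Algebra.Module.Bundles using (Module)
open import Algebra.Module.Structures using (IsLeftModule)
open import Algebra.Module.Structures.Biased using (IsModuleFromLeft)
import Algebra.Module.Construct.TensorUnit as TensorUnit
open import Algebra.Module.Morphism.Structures using (IsModuleHomomorphism)
import Algebra.Properties.AbelianGroup as AbelianGroupProperties
import Algebra.Properties.CommutativeSemigroup as CommutativeSemigroupProperties
open import Data.Bool.Base using (if_then_else_)
open import Data.Fin.Base using (Fin)
open import Data.List.Base using (List; []; _∷_; _++_; _∷ʳ_; foldl; foldr; map; InitLast; _∷ʳ′_; initLast)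
open import Data.List.NonEmpty.Base using (List⁺; _∷_; toList)
open import Data.List.Properties using (foldl-∷ʳ)
open import Data.Nat.Base using (ℕ; suc)
open import Data.Product.Base using (_×_; _,_; ∃-syntax; Σ-syntax)
open import Function.Base using (flip)
open import Function.Bundles using (_↔_)
open import Relation.Binary.PropositionalEquality.Core using (_≡_; refl; sym; trans; cong; cong₂)
open import Relation.Nullary using (yes; no; does; ¬_)
open import Relation.Nullary.Decidable using (map′)
open import Relation.Unary using (Pred; Decidable)

private
  variable
    a x p : Level

Finite : Set a → Set a
Finite A = ∃[ n ] (A ↔ Fin n)

CharacteristicZero : ∀ {c ℓ₁ ℓ₂} → HeytingField c ℓ₁ ℓ₂ → Set ℓ₁
CharacteristicZero k = ∀ n → ¬ (suc n ·1 ≈ 0#)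
  where
  open HeytingField k using (_≈_; 0#; 1#; heytingCommutativeRing)
  open CommutativeRing (HeytingCommutativeRing.commutativeRing heytingCommutativeRing)
    using (+-rawMonoid)
  _·1 : ℕ → HeytingField.Carrier k
  n ·1 = RawMonoidDefs._×_ +-rawMonoid n 1#

------------------------------------------------------------------------
-- Rooted ordered coloured trees

-- A vertex is the left-to-right list of its children, each together
-- with the colour of the edge leading to it.
data Tree (A : Set a) : Set a where
  node : List (A × Tree A) → Tree A

module _ {A : Set a} where

  infixl 7 _∙_

  • : Tree A
  • = node []

  _∙_ : Tree A → Tree A → Tree A
  node ts ∙ node ss = node (ts ++ ss)

  B⁺ : A → Tree A → Tree A
  B⁺ c t = node ((c , t) ∷ [])

  -- a₁⋯aₖ ↦ (B⁺ aₖ ∘ ⋯ ∘ B⁺ a₁) •, so the last letter is next to the root.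
  ⟦_⟧ʷ : List⁺ A → Tree A
  ⟦ w ⟧ʷ = foldl (flip B⁺) • (toList w)

  ⟦_⟧ˢ : List (List⁺ A) → Tree A
  ⟦ I ⟧ˢ = foldr _∙_ • (map ⟦_⟧ʷ I)

  PlantedTall : Pred (Tree A) a
  PlantedTall t = ∃[ w ] ⟦ w ⟧ʷ ≡ t

  Tall : Pred (Tree A) a
  Tall t = ∃[ I ] ⟦ I ⟧ˢ ≡ t

  trivial? : Decidable (_≡ •)
  trivial? (node [])      = yes refl
  trivial? (node (_ ∷ _)) = no λ ()

  private
    B⁺-injective : ∀ {c d : A} {t u} → B⁺ c t ≡ B⁺ d u → t ≡ u
    B⁺-injective refl = refl

    stem : List A → Tree A
    stem = foldl (flip B⁺) •

    Stem : Pred (Tree A) a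
    Stem t = ∃[ as ] stem as ≡ t

    -- Splitting off the last letter of a non-empty word.
    unplant : ∀ w → ∃[ as ] ∃[ c ] ⟦ w ⟧ʷ ≡ B⁺ c (stem as)
    unplant (b ∷ bs) with initLast bs
    ... | []       = [] , b , refl
    ... | cs ∷ʳ′ c = b ∷ cs , c , foldl-∷ʳ (flip B⁺) • c (b ∷ cs)

    plant : ∀ as c → ∃[ w ] ⟦ w ⟧ʷ ≡ B⁺ c (stem as)
    plant []       c = c ∷ [] , refl
    plant (b ∷ bs) c = b ∷ (bs ∷ʳ c) , foldl-∷ʳ (flip B⁺) • c (b ∷ bs)

    plantStem : ∀ {c t} → Stem t → PlantedTall (B⁺ c t)
    plantStem {c} (as , refl) = plant as c

    unplantStem : ∀ {c t} → PlantedTall (B⁺ c t) → Stem t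
    unplantStem (w , w≡) with unplant w
    ... | as , _ , w≡′ = as , B⁺-injective (trans (sym w≡′) w≡)

    ¬planted-• : ¬ PlantedTall •
    ¬planted-• (w , w≡) with unplant w
    ... | _ , _ , w≡′ with trans (sym w≡) w≡′
    ... | ()

    ¬planted-∷∷ : ∀ {e f es} → ¬ PlantedTall (node (e ∷ f ∷ es))
    ¬planted-∷∷ (w , w≡) with unplant w
    ... | _ , _ , w≡′ with trans (sym w≡) w≡′
    ... | ()

    planted⇒stem : ∀ {t} → PlantedTall t → Stem t
    planted⇒stem (b ∷ bs , eq) = b ∷ bs , eq

    stem? : Decidable Stem
    stem? (node [])            = yes ([] , refl)
    stem? (node ((c , t) ∷ [])) =
      map′ (λ s → planted⇒stem (plantStem s))
           (λ { ([] , ()) ; (b ∷ bs , eq) → unplantStem (b ∷ bs , eq) })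
           (stem? t)
    stem? (node (_ ∷ _ ∷ _))   =
      no λ { ([] , ()) ; (b ∷ bs , eq) → ¬planted-∷∷ (b ∷ bs , eq) }

  plantedTall? : Decidable PlantedTall
  plantedTall? (node [])             = no ¬planted-•
  plantedTall? (node ((c , t) ∷ [])) = map′ plantStem unplantStem (stem? t)
  plantedTall? (node (_ ∷ _ ∷ _))    = no ¬planted-∷∷

  private
    tall-∷ : ∀ {c t es} → PlantedTall (B⁺ c t) → Tall (node es) → Tall (node ((c , t) ∷ es))
    tall-∷ (w , w≡) (I , I≡) = w ∷ I , cong₂ _∙_ w≡ I≡

    tall-∷⁻ : ∀ {c t es} → Tall (node ((c , t) ∷ es)) → PlantedTall (B⁺ c t) × Tall (node es)
    tall-∷⁻ (w ∷ I , eq) with unplant w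
    ... | as , d , w≡ with ⟦ I ⟧ˢ in I≡ | trans (sym (cong (_∙ ⟦ I ⟧ˢ) w≡)) eq
    ... | node _ | refl = (w , w≡) , (I , I≡)

  tall? : Decidable Tall
  tall? (node [])             = yes ([] , refl)
  tall? (node ((c , t) ∷ es)) with plantedTall? (B⁺ c t) | tall? (node es)
  ... | yes p | yes q = yes (tall-∷ p q)
  ... | no ¬p | _     = no λ r → let p , _ = tall-∷⁻ r in ¬p p
  ... | yes _ | no ¬q = no λ r → let _ , q = tall-∷⁻ r in ¬q q

------------------------------------------------------------------------
-- Free vector spaces and their duals

module Dual {c ℓ₁ ℓ₂} (k : HeytingField c ℓ₁ ℓ₂) where

  open HeytingField k using (heytingCommutativeRing)

  k-ring : CommutativeRing c ℓ₁
  k-ring = HeytingCommutativeRing.commutativeRing heytingCommutativeRing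

  open CommutativeRing k-ring public
    renaming (Carrier to K; refl to ≈-refl; sym to ≈-sym; trans to ≈-trans)

  infixl 6 _⊕_
  infixr 7 _⊙_
  infix  8 ⊖_
  infix  4 _≋_

  -- Linear combinations of elements of X, as expressions identified by
  -- the least congruence _≋_ satisfying the vector space axioms.  This
  -- needs no decidable equality on X or on k.
  data Combination (X : Set x) : Set (c ⊔ x) where
    basis : X → Combination X
    𝟘     : Combination X
    _⊕_   : Combination X → Combination X → Combination X
    ⊖_    : Combination X → Combination X
    _⊙_   : K → Combination X → Combination X

  data _≋_ {X : Set x} : Combination X → Combination X → Set (c ⊔ ℓ₁ ⊔ x) where
    ≋-refl       : ∀ {u} → u ≋ u
    ≋-sym        : ∀ {u v} → u ≋ v → v ≋ u
    ≋-trans      : ∀ {u v w} → u ≋ v → v ≋ w → u ≋ w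
    ⊕-cong       : ∀ {u u′ v v′} → u ≋ u′ → v ≋ v′ → u ⊕ v ≋ u′ ⊕ v′
    ⊖-cong       : ∀ {u v} → u ≋ v → ⊖ u ≋ ⊖ v
    ⊙-cong       : ∀ {r s u v} → r ≈ s → u ≋ v → r ⊙ u ≋ s ⊙ v
    ⊕-assoc      : ∀ u v w → (u ⊕ v) ⊕ w ≋ u ⊕ (v ⊕ w)
    ⊕-comm       : ∀ u v → u ⊕ v ≋ v ⊕ u
    ⊕-identityˡ  : ∀ u → 𝟘 ⊕ u ≋ u
    ⊖-inverseˡ   : ∀ u → ⊖ u ⊕ u ≋ 𝟘
    ⊙-identityˡ  : ∀ u → 1# ⊙ u ≋ u
    ⊙-assoc      : ∀ r s u → (r * s) ⊙ u ≋ r ⊙ (s ⊙ u)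
    ⊙-distribˡ   : ∀ r u v → r ⊙ (u ⊕ v) ≋ r ⊙ u ⊕ r ⊙ v
    ⊙-distribʳ   : ∀ u r s → (r + s) ⊙ u ≋ r ⊙ u ⊕ s ⊙ u
    ⊙-zeroˡ      : ∀ u → 0# ⊙ u ≋ 𝟘
    ⊙-zeroʳ      : ∀ r → r ⊙ 𝟘 ≋ 𝟘

  -- The vector space with basis X.
  k⟨_⟩ : Set x → Module k-ring (c ⊔ x) (c ⊔ ℓ₁ ⊔ x)
  k⟨ X ⟩ = record
    { Carrierᴹ = Combination X
    ; _≈ᴹ_ = _≋_
    ; _+ᴹ_ = _⊕_
    ; _*ₗ_ = _⊙_
    ; _*ᵣ_ = flip _⊙_
    ; 0ᴹ = 𝟘
    ; -ᴹ_ = ⊖_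
    ; isModule = IsModuleFromLeft.isModule {commutativeRing = k-ring}
        (record { isLeftModule = isLeftModule })
    }
    where
    isLeftModule : IsLeftModule ring (_≋_ {X = X}) _⊕_ 𝟘 ⊖_ _⊙_
    isLeftModule = record
      { isLeftSemimodule = record
        { +ᴹ-isCommutativeMonoid = record
          { isMonoid = record
            { isSemigroup = record
              { isMagma = record
                { isEquivalence = record { refl = ≋-refl ; sym = ≋-sym ; trans = ≋-trans }
                ; ∙-cong = ⊕-cong
                }
              ; assoc = ⊕-assoc
              }
            ; identity = ⊕-identityˡ , λ u → ≋-trans (⊕-comm u 𝟘) (⊕-identityˡ u)
            }
          ; comm = ⊕-comm
          }
        ; isPreleftSemimodule = record
          { *ₗ-cong = ⊙-cong
          ; *ₗ-zeroˡ = ⊙-zeroˡ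
          ; *ₗ-distribʳ = ⊙-distribʳ
          ; *ₗ-identityˡ = ⊙-identityˡ
          ; *ₗ-assoc = ⊙-assoc
          ; *ₗ-zeroʳ = ⊙-zeroʳ
          ; *ₗ-distribˡ = ⊙-distribˡ
          }
        }
      ; -ᴹ‿cong = ⊖-cong
      ; -ᴹ‿inverse = ⊖-inverseˡ , λ u → ≋-trans (⊕-comm u (⊖ u)) (⊖-inverseˡ u)
      }

  -- The linear dual of k⟨ X ⟩.
  record Functional (X : Set x) : Set (c ⊔ ℓ₁ ⊔ x) where
    field
      apply    : Combination X → K
      isLinear : IsModuleHomomorphism (Module.rawModule k⟨ X ⟩)
                   (Module.rawModule (TensorUnit.⟨module⟩ {R = k-ring})) apply
    open IsModuleHomomorphism isLinear public

  open Functional public using (apply)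

  infix 4 _≈*_
  _≈*_ : {X : Set x} → Functional X → Functional X → Set (c ⊔ ℓ₁ ⊔ x)
  F ≈* G = ∀ v → apply F v ≈ apply G v

  ⟨_,_⟩ : {X : Set x} → Functional X → X → K
  ⟨ F , t ⟩ = apply F (basis t)

  private
    open AbelianGroupProperties +-abelianGroup using (⁻¹-∙-comm)
    open CommutativeSemigroupProperties
      (CommutativeRing.+-commutativeSemigroup k-ring) using (interchange)

    mkFunctional : {X : Set x} (f : Combination X → K) →
      (∀ {u v} → u ≋ v → f u ≈ f v) →
      (∀ u v → f (u ⊕ v) ≈ f u + f v) →
      f 𝟘 ≈ 0# →
      (∀ u → f (⊖ u) ≈ - f u) →
      (∀ r u → f (r ⊙ u) ≈ r * f u) →
      Functional X
    mkFunctional f f-cong f-⊕ f-𝟘 f-⊖ f-⊙ = record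
      { apply = f
      ; isLinear = record
        { isBimoduleHomomorphism = record
          { +ᴹ-isGroupHomomorphism = record
            { isMonoidHomomorphism = record
              { isMagmaHomomorphism = record
                { isRelHomomorphism = record { cong = f-cong }
                ; homo = f-⊕
                }
              ; ε-homo = f-𝟘
              }
            ; ⁻¹-homo = f-⊖
            }
          ; *ₗ-homo = f-⊙
          ; *ᵣ-homo = λ r u → ≈-trans (f-⊙ r u) (*-comm r (f u))
          }
        }
      }

    extend : {X : Set x} → (X → K) → Combination X → K
    extend f (basis t) = f t
    extend f 𝟘         = 0#
    extend f (u ⊕ v)   = extend f u + extend f v
    extend f (⊖ u)     = - extend f u
    extend f (r ⊙ u)   = r * extend f u

    extend-cong : {X : Set x} (f : X → K) → ∀ {u v} → u ≋ v → extend f u ≈ extend f v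
    extend-cong f ≋-refl             = ≈-refl
    extend-cong f (≋-sym e)          = ≈-sym (extend-cong f e)
    extend-cong f (≋-trans e e′)     = ≈-trans (extend-cong f e) (extend-cong f e′)
    extend-cong f (⊕-cong e e′)      = +-cong (extend-cong f e) (extend-cong f e′)
    extend-cong f (⊖-cong e)         = -‿cong (extend-cong f e)
    extend-cong f (⊙-cong r≈s e)     = *-cong r≈s (extend-cong f e)
    extend-cong f (⊕-assoc u v w)    = +-assoc _ _ _
    extend-cong f (⊕-comm u v)       = +-comm _ _
    extend-cong f (⊕-identityˡ u)    = +-identityˡ _
    extend-cong f (⊖-inverseˡ u)     = -‿inverseˡ _
    extend-cong f (⊙-identityˡ u)    = *-identityˡ _
    extend-cong f (⊙-assoc r s u)    = *-assoc _ _ _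
    extend-cong f (⊙-distribˡ r u v) = distribˡ _ _ _
    extend-cong f (⊙-distribʳ u r s) = distribʳ _ _ _
    extend-cong f (⊙-zeroˡ u)        = zeroˡ _
    extend-cong f (⊙-zeroʳ r)        = zeroʳ _

  -- The formal series Σₜ f(t) t, that is, the linear extension of f.
  series : {X : Set x} → (X → K) → Functional X
  series f = mkFunctional (extend f) (extend-cong f)
    (λ _ _ → ≈-refl) ≈-refl (λ _ → ≈-refl) (λ _ _ → ≈-refl)

  characteristic : {X : Set x} {P : Pred X p} → Decidable P → Functional X
  characteristic P? = series λ t → if does (P? t) then 1# else 0#

  infixl 6 _+*_
  _+*_ : {X : Set x} → Functional X → Functional X → Functional X
  F +* G = mkFunctional (λ v → apply F v + apply G v)
    (λ e → +-cong (F.⟦⟧-cong e) (G.⟦⟧-cong e))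
    (λ u v → ≈-trans (+-cong (F.+ᴹ-homo u v) (G.+ᴹ-homo u v)) (interchange _ _ _ _))
    (≈-trans (+-cong F.0ᴹ-homo G.0ᴹ-homo) (+-identityˡ 0#))
    (λ u → ≈-trans (+-cong (F.-ᴹ-homo u) (G.-ᴹ-homo u)) (⁻¹-∙-comm _ _))
    (λ r u → ≈-trans (+-cong (F.*ₗ-homo r u) (G.*ₗ-homo r u)) (≈-sym (distribˡ _ _ _)))
    where
    module F = Functional F
    module G = Functional G

  0* : {X : Set x} → Functional X
  0* = series λ _ → 0#

  -- k⟨ X ⟩ ⊗ k⟨ Y ⟩ is taken to be k⟨ X × Y ⟩, with (t , s) in the role
  -- of the basis element t ⊗ s.
  infixr 7 _⊗_
  _⊗_ : ∀ {y} {X : Set x} {Y : Set y} → Functional X → Functional Y → Functional (X × Y)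
  F ⊗ G = series λ (t , s) → ⟨ F , t ⟩ * ⟨ G , s ⟩

------------------------------------------------------------------------
-- Formal tree series

module TreeSeries {c ℓ₁ ℓ₂} (k : HeytingField c ℓ₁ ℓ₂) (A : Set a) where

  open Dual k public

  Series : Set (c ⊔ ℓ₁ ⊔ a)
  Series = Functional (Tree A)

  δ : Series → Functional (Tree A × Tree A)
  δ G = series λ (t , s) → ⟨ G , t ∙ s ⟩

  -- δ G lies in the image of (k T_A)* ⊗ (k T_A)*, whose elements are the
  -- finite sums of tensors G₁ ⊗ G₂.  The pruning coproduct plays no part
  -- in this condition: it only determines the product of the dual.
  InRestrictedDual : Series → Set (c ⊔ ℓ₁ ⊔ a)
  InRestrictedDual G =
    Σ[ Gs ∈ List (Series × Series) ] δ G ≈* foldr (λ (G₁ , G₂) S → G₁ ⊗ G₂ +* S) 0* Gs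

  -- The series •, which is the unit of the restricted dual.
  •* : Series
  •* = characteristic trivial?

  record IsPrimitive (G : Series) : Set (c ⊔ ℓ₁ ⊔ a) where
    field
      inRestrictedDual : InRestrictedDual G
      δ-primitive      : δ G ≈* •* ⊗ G +* G ⊗ •*

  -- The counit of the restricted dual is G ↦ ⟨ G , • ⟩; requiring the
  -- value 1 excludes G = 0.
  record IsGroupLike (G : Series) : Set (c ⊔ ℓ₁ ⊔ a) where
    field
      inRestrictedDual : InRestrictedDual G
      counit           : ⟨ G , • ⟩ ≈ 1#
      δ-groupLike      : δ G ≈* G ⊗ G

  H : Series
  H = characteristic plantedTall?

  H* : Series
  H* = characteristic tall?

{-# OPTIONS --safe #-}
-- Linear functionals are determined by their values on basis elements t ⊗ s.
-- A planted tree has exactly one branch, so t . s is planted tall iff one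
-- factor is • and the other is planted tall.  A tree is tall iff each of its
-- branches is, so t . s is tall iff both t and s are.

module Submission where

open import Defs
open import Algebra.Apartness.Bundles using (HeytingField)
open import Data.Bool.Base using (true; false; _∧_; if_then_else_)
open import Data.List.Base using (List; []; _∷_; _++_)
open import Data.Product.Base using (_×_; _,_)
open import Relation.Binary.PropositionalEquality.Core using (_≡_; refl)
open import Relation.Nullary using (yes; no; does)

-- Phrased with Booleans rather than with `Tall` so that it rewrites the coefficients of `H*`
-- directly.
does-tall?-++ : ∀ {a} {A : Set a} (ts ss : List (A × Tree A)) →
  does (tall? (node (ts ++ ss))) ≡ does (tall? (node ts)) ∧ does (tall? (node ss))
does-tall?-++ []             ss = refl
does-tall?-++ ((c , t) ∷ ts) ss
  with plantedTall? (B⁺ c t) | tall? (node ts) | tall? (node (ts ++ ss)) | does-tall?-++ ts ss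
-- A planted tall first branch changes neither side, so the goal is the induction hypothesis itself,
-- even in the contradictory cases.
... | yes _ | yes _ | yes _ | ih = ih
... | yes _ | yes _ | no _  | ih = ih
... | yes _ | no _  | yes _ | ih = ih
... | yes _ | no _  | no _  | ih = ih
... | no _  | _     | _     | _  = refl

module _ {c ℓ₁ ℓ₂} (k : HeytingField c ℓ₁ ℓ₂) where

  open Dual k

  -- A combination is a syntactic expression, so structural induction on it suffices, with linearity
  -- settling each constructor other than `basis`.
  ≈*-ext : ∀ {x} {X : Set x} (F G : Functional X) →
    (∀ t → ⟨ F , t ⟩ ≈ ⟨ G , t ⟩) → F ≈* G
  ≈*-ext F G F≈G = go
    where
    module F = Functional F
    module G = Functional G
    go : F ≈* G
    go (basis t) = F≈G t
    go 𝟘         = ≈-trans F.0ᴹ-homo (≈-sym G.0ᴹ-homo)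
    go (u ⊕ v)   = ≈-trans (F.+ᴹ-homo u v)
                     (≈-trans (+-cong (go u) (go v)) (≈-sym (G.+ᴹ-homo u v)))
    go (⊖ u)     = ≈-trans (F.-ᴹ-homo u) (≈-trans (-‿cong (go u)) (≈-sym (G.-ᴹ-homo u)))
    go (r ⊙ u)   = ≈-trans (F.*ₗ-homo r u)
                     (≈-trans (*-cong ≈-refl (go u)) (≈-sym (G.*ₗ-homo r u)))

  +*-identityʳ : ∀ {x} {X : Set x} (F : Functional X) → F +* 0* ≈* F
  +*-identityʳ F = ≈*-ext (F +* 0*) F λ _ → +-identityʳ _

  indicator-∧ : ∀ b b′ →
    (if b ∧ b′ then 1# else 0#) ≈ (if b then 1# else 0#) * (if b′ then 1# else 0#)
  indicator-∧ true  _ = ≈-sym (*-identityˡ _)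
  indicator-∧ false _ = ≈-sym (zeroˡ _)

  module _ {a} (A : Set a) where

    open TreeSeries k A using (δ; •*; H; H*; IsPrimitive; IsGroupLike)

    δ-H : δ H ≈* •* ⊗ H +* H ⊗ •*
    δ-H = ≈*-ext (δ H) (•* ⊗ H +* H ⊗ •*) pointwise
      where
      pointwise : ∀ ts → ⟨ δ H , ts ⟩ ≈ ⟨ •* ⊗ H +* H ⊗ •* , ts ⟩
      -- The split follows the clauses of `plantedTall?`, so coefficients compute. Here `ss` may be
      -- empty: `H` vanishes at `•`, so both sides are then zero.
      pointwise (node [] , node ss) =
        ≈-sym (≈-trans (+-cong (*-identityˡ _) (zeroˡ _)) (+-identityʳ _))
      pointwise (node (e ∷ []) , node []) =
        ≈-sym (≈-trans (+-cong (zeroˡ _) (*-identityʳ _)) (+-identityˡ _))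
      pointwise (node (e ∷ []) , node (_ ∷ _)) =
        ≈-sym (≈-trans (+-cong (zeroˡ _) (zeroʳ _)) (+-identityˡ _))
      -- Two branches on the left already make `H` vanish on this factor and on the product,
      -- whatever the right factor is.
      pointwise (node (_ ∷ _ ∷ _) , node _) =
        ≈-sym (≈-trans (+-cong (zeroˡ _) (zeroˡ _)) (+-identityˡ _))

    δ-H* : δ H* ≈* H* ⊗ H*
    δ-H* = ≈*-ext (δ H*) (H* ⊗ H*) pointwise
      where
      pointwise : ∀ ts → ⟨ δ H* , ts ⟩ ≈ ⟨ H* ⊗ H* , ts ⟩
      pointwise (node ts , node ss) rewrite does-tall?-++ ts ss = indicator-∧ _ _

    H-isPrimitive : IsPrimitive H
    H-isPrimitive = record
      -- The coproduct formula itself supplies the finite sum of tensors; only the `0*` ending the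
      -- fold has to be absorbed.
      { inRestrictedDual = (•* , H) ∷ (H , •*) ∷ [] , λ v →
          ≈-trans (δ-H v) (+-cong ≈-refl (≈-sym (+*-identityʳ (H ⊗ •*) v)))
      ; δ-primitive = δ-H
      }

    H*-isGroupLike : IsGroupLike H*
    H*-isGroupLike = record
      { inRestrictedDual = (H* , H*) ∷ [] , λ v →
          ≈-trans (δ-H* v) (≈-sym (+*-identityʳ (H* ⊗ H*) v))
      -- `•` is the tall tree of the empty sentence, so its coefficient computes to `1#`.
      ; counit = ≈-refl
      ; δ-groupLike = δ-H*
      }

proposition6p3 : ∀ {c ℓ₁ ℓ₂ a} (k : HeytingField c ℓ₁ ℓ₂) → CharacteristicZero k →
    (A : Set a) → Finite A →
    let open TreeSeries k A in
    IsPrimitive H × IsGroupLike H*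
proposition6p3 k _ A _ = H-isPrimitive k A , H*-isGroupLike k A
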